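{- Let $k$ be a given positive integer. Then, as $n\to\infty$, $$\mathbb{E}[X_{n,n+1}^k]=\left(\frac{1}{10}\right)^k n^{2k}+O(n^{2k-1}).$$
   Context: A partition $\lambda=(\lambda_1\ge\dots\ge\lambda_\ell)$ has size $|\lambda|=\sum_i\lambda_i$. The hook length of a box of its Young diagram is the number of boxes directly to its right, directly below it, plus the box itself. For a positive integer $t$, $\lambda$ is a $t$-core if none of its hook lengths is divisible by $t$; an $(s,t)$-core is both an $s$-core and a $t$-core. $X_{n,n+1}$ denotes the size of a partition chosen uniformly at random from the finite set of $(n,n+1)$-core partitions with distinct parts. -}

module Defs where

open import Data.Nat as ℕ using (ℕ; zero; suc; _∸_; _<_; _<?_)
open import Data.Nat.Divisibility using (_∣_)
open import Data.List using (List; []; _∷_; length; filter; map)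
open import Data.Nat.ListAction using (sum)
open import Data.List.Relation.Unary.All using (All)
open import Data.List.Relation.Unary.Linked using (Linked)
open import Data.List.Relation.Unary.Unique.Propositional using (Unique)
open import Data.List.Membership.Propositional using (_∈_)
open import Data.Integer using (+_)
open import Data.Rational using (ℚ; 0ℚ; 1ℚ; _/_; _*_)
open import Data.Product using (_×_)
open import Function.Bundles using (_⇔_)
open import Relation.Nullary using (¬_)

DistinctPartition : List ℕ → Set
DistinctPartition λs = Linked ℕ._>_ λs × All (0 <_) λs

part : List ℕ → ℕ → ℕ
part []       _       = 0
part (x ∷ _)  zero    = x
part (_ ∷ xs) (suc i) = part xs i

conj : List ℕ → ℕ → ℕ
conj λs j = length (filter (j <?_) λs)

IsBox : List ℕ → ℕ → ℕ → Set
IsBox λs i j = (i < length λs) × (j < part λs i)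

-- hook length of box (i , j): arm + leg + 1
hook : List ℕ → ℕ → ℕ → ℕ
hook λs i j = suc ((part λs i ∸ suc j) ℕ.+ (conj λs j ∸ suc i))

IsCore : ℕ → List ℕ → Set
IsCore t λs = ∀ i j → IsBox λs i j → ¬ (t ∣ hook λs i j)

size : List ℕ → ℕ
size = sum

IsDistinctCore : ℕ → List ℕ → Set
IsDistinctCore n λs = DistinctPartition λs × IsCore n λs × IsCore (suc n) λs

Enumerates : ℕ → List (List ℕ) → Set
Enumerates n L = Unique L × (∀ λs → (λs ∈ L) ⇔ IsDistinctCore n λs)

moment : ℕ → List (List ℕ) → ℚ
moment k []          = 0ℚ
moment k L@(_ ∷ _)   = + sum (map (λ λs → size λs ℕ.^ k) L) / length L

_^ℚ_ : ℚ → ℕ → ℚ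
q ^ℚ zero  = 1ℚ
q ^ℚ suc m = q * (q ^ℚ m)

{-# OPTIONS --safe --termination-depth=2 #-}

-- Along the first row of a partition with distinct parts the hook lengths drop by 1 or 2 at each
-- step and end at 1, so such a partition is an (n, n+1)-core exactly when its largest part plus
-- its length is at most n. Splitting off the partitions where this sum equals n gives a Fibonacci
-- recursion, and with it closed forms for the sums of ℓ, s, ℓ², ℓs, s² over all cores, where ℓ is
-- the length and s the size. In Σ (10 s − n²) and Σ (10 s − n²)² the leading terms cancel, so
-- these sums are O(n) and O(n³) times the number of cores. As 0 ≤ 10 s ≤ 10 n², a first-order
-- Taylor expansion of (10 s)ᵏ at n² then has average n²ᵏ + O(n²ᵏ⁻¹).

module Submission where

open import Defs
open import Data.List.Membership.Propositional using (_∈_)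
import Data.List.Properties as Listₚ
import Data.Nat.Properties as ℕₚ
open import Relation.Binary.PropositionalEquality

-- Partitions with distinct parts, listed by largest part plus length.

module Enumeration where

  open import Data.Empty using (⊥-elim)
  open import Data.List using (List; []; _∷_; _++_; map; length)
  open import Data.List.Membership.Propositional.Properties using (∈-map⁺; ∈-map⁻; ∈-++⁺ˡ; ∈-++⁺ʳ; ∈-++⁻)
  open import Data.List.Relation.Unary.All as All using (All; []; _∷_)
  open import Data.List.Relation.Unary.AllPairs as AllPairs using ([]; _∷_)
  open import Data.List.Relation.Unary.Any using (here)
  open import Data.List.Relation.Unary.Linked using ([-]; _∷_; [])
  open import Data.List.Relation.Unary.Linked.Properties using (Linked⇒AllPairs)
  open import Data.List.Relation.Unary.Unique.Propositional using (Unique)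
  import Data.List.Relation.Unary.Unique.Propositional.Properties as Uniqueₚ
  open import Data.Nat using (ℕ; zero; suc; _+_; _∸_; _≤_; _<_; _<?_; _≤?_; z≤n; s≤s; z<s)
  open import Data.Nat.Divisibility using (∣-reflexive; ∣⇒≤)
  open import Data.Product using (_×_; _,_; proj₁; proj₂)
  open import Data.Sum using (inj₁; inj₂)
  open import Function using (_∘_)
  open import Function.Bundles using (mk⇔)
  open import Relation.Nullary using (¬_; yes; no)

  -- The new part is chosen so that a semiperimeter of at most n becomes exactly n + 2.
  extend : ℕ → List ℕ → List ℕ
  extend n λs = (suc n ∸ length λs) ∷ λs

  -- Sorted by semiperimeter: values up to n + 1 come from the previous list, and the value n + 2
  -- arises from a unique member two lists back. For 0 and 1 only the empty partition fits, since
  -- one positive part already gives 2.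
  cores : ℕ → List (List ℕ)
  cores zero          = [] ∷ []
  cores (suc zero)    = [] ∷ []
  cores (suc (suc n)) = cores (suc n) ++ map (extend n) (cores n)

  semiperimeter : List ℕ → ℕ
  semiperimeter λs = part λs 0 + length λs

  distinct-∷ : ∀ {x λs} → DistinctPartition λs → part λs 0 < x → DistinctPartition (x ∷ λs)
  distinct-∷ {x} {[]}     (_ , pos)  p = [-] , p ∷ pos
  distinct-∷ {x} {y ∷ ys} (lk , pos) p = p ∷ lk , ℕₚ.≤-<-trans z≤n p ∷ pos

  distinct-tail : ∀ {x λs} → DistinctPartition (x ∷ λs) → DistinctPartition λs × part λs 0 < x
  distinct-tail {x} {[]}     (_ , px ∷ pos)  = ([] , pos) , px
  distinct-tail {x} {y ∷ ys} (p ∷ lk , px ∷ pos) = (lk , pos) , p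

  distinct-head : ∀ {x λs} → DistinctPartition (x ∷ λs) → All (_< x) λs
  distinct-head (lk , _) = AllPairs.head (Linked⇒AllPairs (λ p q → ℕₚ.<-trans q p) lk)

  length≤semiperimeter : ∀ {n} λs → semiperimeter λs ≤ n → length λs ≤ n
  length≤semiperimeter λs = ℕₚ.≤-trans (ℕₚ.m≤n+m _ (part λs 0))

  semiperimeter-extend : ∀ n λs → semiperimeter λs ≤ n → semiperimeter (extend n λs) ≡ suc (suc n)
  semiperimeter-extend n λs p = trans (ℕₚ.+-suc _ _)
    (cong suc (ℕₚ.m∸n+n≡m (ℕₚ.m≤n⇒m≤1+n (length≤semiperimeter λs p))))

  part<extend : ∀ n λs → semiperimeter λs ≤ n → part λs 0 < suc n ∸ length λs
  part<extend n λs p = ℕₚ.m+n≤o⇒m≤o∸n (suc (part λs 0)) (s≤s p)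

  ∈cores⇒ : ∀ n {λs} → λs ∈ cores n → DistinctPartition λs × semiperimeter λs ≤ n
  ∈cores⇒ zero       (here refl) = ([] , []) , z≤n
  ∈cores⇒ (suc zero) (here refl) = ([] , []) , z≤n
  ∈cores⇒ (suc (suc n)) i with ∈-++⁻ (cores (suc n)) i
  ... | inj₁ j = let d , p = ∈cores⇒ (suc n) j in d , ℕₚ.m≤n⇒m≤1+n p
  ... | inj₂ j with ∈-map⁻ (extend n) j
  ... | μ , k , refl = let d , p = ∈cores⇒ n k in
    distinct-∷ d (part<extend n μ p) , ℕₚ.≤-reflexive (semiperimeter-extend n μ p)

  -- If the semiperimeter is exactly n + 2, the first part is forced by the number of the others.
  -- Deleting it leaves a semiperimeter of at most n, because the next part is strictly smaller.
  ⇒∈cores : ∀ n λs → DistinctPartition λs → semiperimeter λs ≤ n → λs ∈ cores n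
  ⇒∈cores zero       []       _ _ = here refl
  ⇒∈cores (suc zero) []       _ _ = here refl
  ⇒∈cores (suc zero) (suc x ∷ xs) _ (s≤s p) with () ← subst (_≤ 0) (ℕₚ.+-suc x (length xs)) p
  ⇒∈cores (suc zero) (zero ∷ xs) (_ , () ∷ _) _
  ⇒∈cores zero (suc x ∷ xs) _ ()
  ⇒∈cores zero (zero ∷ xs) (_ , () ∷ _) _
  ⇒∈cores (suc (suc n)) λs d p with semiperimeter λs ≤? suc n
  ... | yes q = ∈-++⁺ˡ (⇒∈cores (suc n) λs d q)
  ⇒∈cores (suc (suc n)) [] d p | no q = ⊥-elim (q z≤n)
  ⇒∈cores (suc (suc n)) (x ∷ xs) d p | no q =
    ∈-++⁺ʳ (cores (suc n)) (subst (λ y → (y ∷ xs) ∈ map (extend n) (cores n)) x≡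
      (∈-map⁺ (extend n) (⇒∈cores n xs (proj₁ d′) tail≤)))
    where
    d′ = distinct-tail d
    sum≡ : x + length xs ≡ suc n
    sum≡ = ℕₚ.suc-injective (trans (sym (ℕₚ.+-suc x (length xs))) (ℕₚ.≤-antisym p (ℕₚ.≰⇒> q)))
    x≡ : suc n ∸ length xs ≡ x
    x≡ = trans (cong (_∸ length xs) (sym sum≡)) (ℕₚ.m+n∸n≡m x (length xs))
    tail≤ : semiperimeter xs ≤ n
    tail≤ = ℕₚ.≤-pred (subst (semiperimeter xs <_) sum≡ (ℕₚ.+-monoˡ-< (length xs) (proj₂ d′)))

  cores-unique : ∀ n → Unique (cores n)
  cores-unique zero          = [] ∷ []
  cores-unique (suc zero)    = [] ∷ []
  cores-unique (suc (suc n)) = Uniqueₚ.++⁺ (cores-unique (suc n))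
    (Uniqueₚ.map⁺ Listₚ.∷-injectiveʳ (cores-unique n)) disjoint
    where
    -- The first list has semiperimeters at most n + 1, the second exactly n + 2.
    disjoint : ∀ {λs} → ¬ (λs ∈ cores (suc n) × λs ∈ map (extend n) (cores n))
    disjoint (i , j) with ∈-map⁻ (extend n) j
    ... | μ , k , refl = ℕₚ.1+n≰n (subst (_≤ suc n)
      (semiperimeter-extend n μ (proj₂ (∈cores⇒ n k))) (proj₂ (∈cores⇒ (suc n) i)))

  -- Hook lengths and the core condition.

  part≤part₀ : ∀ {λs} → DistinctPartition λs → ∀ i → part λs i ≤ part λs 0
  part≤part₀ {[]}    d i       = z≤n
  part≤part₀ {x ∷ λs} d zero   = ℕₚ.≤-refl
  part≤part₀ {x ∷ λs} d (suc i) = let d′ , p = distinct-tail d in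
    ℕₚ.≤-trans (part≤part₀ d′ i) (ℕₚ.<⇒≤ p)

  -- The arm is less than the row length, the leg is less than the number of rows, and no row
  -- exceeds the first.
  hook<semiperimeter : ∀ {λs} → DistinctPartition λs → ∀ i j → IsBox λs i j →
    hook λs i j < semiperimeter λs
  hook<semiperimeter {λs} d i j (i< , j<) = begin
    2 + ((part λs i ∸ suc j) + (conj λs j ∸ suc i))
      ≤⟨ ℕₚ.+-monoʳ-≤ 2 (ℕₚ.+-mono-≤ (ℕₚ.∸-monoʳ-≤ (part λs i) (s≤s (z≤n {j})))
           (ℕₚ.∸-mono (Listₚ.length-filter (j <?_) λs) (s≤s (z≤n {i})))) ⟩
    2 + ((part λs i ∸ 1) + (length λs ∸ 1))
      ≡⟨ cong suc (ℕₚ.+-suc (part λs i ∸ 1) (length λs ∸ 1)) ⟨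
    (1 + (part λs i ∸ 1)) + (1 + (length λs ∸ 1))
      ≡⟨ cong₂ _+_ (ℕₚ.m+[n∸m]≡n (ℕₚ.≤-<-trans z≤n j<))
           (ℕₚ.m+[n∸m]≡n (ℕₚ.≤-<-trans z≤n i<)) ⟩
    part λs i + length λs
      ≤⟨ ℕₚ.+-monoˡ-≤ (length λs) (part≤part₀ d i) ⟩
    semiperimeter λs ∎
    where open ℕₚ.≤-Reasoning

  -- A hook length is positive and smaller than `t`, so `t` cannot divide it.
  semiperimeter≤⇒core : ∀ {t λs} → DistinctPartition λs → semiperimeter λs ≤ t → IsCore t λs
  semiperimeter≤⇒core d p i j box t∣h =
    ℕₚ.<⇒≱ (ℕₚ.<-≤-trans (hook<semiperimeter d i j box) p) (∣⇒≤ t∣h)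

  conj-none : ∀ {j λs} → All (_≤ j) λs → conj λs j ≡ 0
  conj-none all = cong length (Listₚ.filter-none (_ <?_) (All.map ℕₚ.≤⇒≯ all))

  -- The two column lengths differ by the number of parts equal to j + 1, and distinct parts allow
  -- at most one.
  conj-step : ∀ {λs} → DistinctPartition λs → ∀ j → conj λs j ≤ suc (conj λs (suc j))
  conj-step {[]}    d j = z≤n
  conj-step {x ∷ λs} d j with j <? x
  ... | no j≮x = subst (_≤ suc (conj (x ∷ λs) (suc j)))
    (sym (trans (cong length (Listₚ.filter-reject (j <?_) j≮x))
      (conj-none (All.map (λ y<x →
        ℕₚ.<⇒≤ (ℕₚ.<-≤-trans y<x (ℕₚ.≮⇒≥ j≮x))) (distinct-head d))))) z≤n
  ... | yes j<x with suc j <? x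
  ... | yes 1+j<x = subst₂ _≤_
    (sym (cong length (Listₚ.filter-accept (j <?_) j<x)))
    (sym (cong (suc ∘ length) (Listₚ.filter-accept (suc j <?_) 1+j<x)))
    (s≤s (conj-step (proj₁ (distinct-tail d)) j))
  ... | no 1+j≮x = subst (_≤ suc (conj (x ∷ λs) (suc j)))
    (sym (trans (cong length (Listₚ.filter-accept (j <?_) j<x))
      (cong suc (conj-none (All.map (λ y<x →
        ℕₚ.≤-pred (ℕₚ.<-≤-trans y<x (ℕₚ.≮⇒≥ 1+j≮x))) (distinct-head d))))))
    (s≤s z≤n)

  -- One box to the right, the arm is shorter by at most one and, by `conj-step`, so is the leg.
  hook₀-step : ∀ {λs} → DistinctPartition λs → ∀ j → hook λs 0 j ≤ 2 + hook λs 0 (suc j)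
  hook₀-step {λs} d j = s≤s (begin
    (part λs 0 ∸ suc j) + (conj λs j ∸ 1)
      ≤⟨ ℕₚ.+-mono-≤
          (ℕₚ.≤-trans (ℕₚ.m≤n+m∸n _ 1) (ℕₚ.≤-reflexive (cong suc
            (trans (ℕₚ.∸-+-assoc (part λs 0) (suc j) 1) (cong (part λs 0 ∸_) (ℕₚ.+-comm (suc j) 1))))))
          (ℕₚ.≤-trans (ℕₚ.∸-monoˡ-≤ 1 (conj-step d j)) (ℕₚ.m≤n+m∸n _ 1)) ⟩
    suc (part λs 0 ∸ suc (suc j)) + suc (conj λs (suc j) ∸ 1)
      ≡⟨ cong suc (ℕₚ.+-suc _ _) ⟩
    suc (hook λs 0 (suc j)) ∎)
    where open ℕₚ.≤-Reasoning

  hook₀₀ : ∀ {x λs} → DistinctPartition (x ∷ λs) → suc (hook (x ∷ λs) 0 0) ≡ semiperimeter (x ∷ λs)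
  hook₀₀ {suc x} {λs} (_ , _ ∷ pos) = cong suc (trans
    (cong (λ xs → suc (x + length xs)) (Listₚ.filter-all (0 <?_) pos))
    (sym (ℕₚ.+-suc x (length λs))))

  hook₀-last : ∀ {x λs} → DistinctPartition (suc x ∷ λs) → hook (suc x ∷ λs) 0 x ≡ 1
  hook₀-last {x} {λs} d = cong suc (cong₂ _+_ (ℕₚ.n∸n≡0 x)
    (cong (_∸ 1) (trans (cong length (Listₚ.filter-accept (x <?_) {suc x} {λs} ℕₚ.≤-refl))
      (cong suc (conj-none (All.map ℕₚ.≤-pred (distinct-head d)))))))

  -- Along the first row the hooks drop by at most two and end at 1, so they cannot jump over
  -- both n and n + 1.
  core⇒semiperimeter≤ : ∀ {n} → 0 < n → ∀ {λs} → IsDistinctCore n λs → semiperimeter λs ≤ n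
  core⇒semiperimeter≤ 0<n {[]} _ = z≤n
  core⇒semiperimeter≤ 0<n {zero ∷ λs} ((_ , () ∷ _) , _)
  core⇒semiperimeter≤ {n} 0<n {λs@(suc x ∷ μ)} (d , c₀ , c₁) with semiperimeter λs ≤? n
  ... | yes p = p
  ... | no p = ⊥-elim (ℕₚ.<⇒≱ (s≤s (s≤s z≤n)) (subst (2 + n ≤_) (hook₀-last d) (above x ℕₚ.≤-refl)))
    where
    -- A hook of at least n is neither n nor n + 1, hence at least n + 2; the next one is then at
    -- least n again. At the last box this contradicts the hook length 1.
    skip : ∀ j → j ≤ x → n ≤ hook λs 0 j → 2 + n ≤ hook λs 0 j
    skip j j≤x n≤h =
      ℕₚ.≤∧≢⇒< (ℕₚ.≤∧≢⇒< n≤h (λ e → c₀ 0 j (z<s , s≤s j≤x) (∣-reflexive e)))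
        (λ e → c₁ 0 j (z<s , s≤s j≤x) (∣-reflexive e))
    above : ∀ j → j ≤ x → 2 + n ≤ hook λs 0 j
    above zero    j≤x = skip 0 j≤x (ℕₚ.≤-pred (subst (n <_) (sym (hook₀₀ d)) (ℕₚ.≰⇒> p)))
    above (suc j) j<x = skip (suc j) j<x
      (ℕₚ.≤-pred (ℕₚ.≤-pred (ℕₚ.≤-trans (above j (ℕₚ.<⇒≤ j<x)) (hook₀-step d j))))

  cores-enumerates : ∀ {n} → 0 < n → Enumerates n (cores n)
  cores-enumerates {n} 0<n = cores-unique n , λ λs → mk⇔
    (λ i → let d , p = ∈cores⇒ n i in
      d , semiperimeter≤⇒core d p , semiperimeter≤⇒core d (ℕₚ.m≤n⇒m≤1+n p))
    (λ c → ⇒∈cores n λs (proj₁ c) (core⇒semiperimeter≤ 0<n c))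

module Asymptotics where

  open Enumeration
  open import Data.Integer as ℤ using (ℤ; +_; -_; _+_; _*_; _-_; ∣_∣)
  import Data.Integer.Properties as ℤₚ
  open import Data.Integer.Solver using (module +-*-Solver)
  open +-*-Solver using (Polynomial; solve; con; _:+_; _:*_; _:-_; :-_; _:=_)
  open import Data.List using (List; []; _∷_; _++_; map; length)
  open import Data.List.Relation.Unary.Any using (here; there)
  open import Data.Nat as ℕ using (ℕ; zero; suc; _^_; z≤n; s≤s)
  open import Data.Nat.ListAction using (sum)
  import Data.Nat.Solver
  open Data.Nat.Solver.+-*-Solver using ()
    renaming (solve to ℕ-solve; con to κ; _:+_ to _⊕_; _:*_ to _⊗_; _:=_ to _⊜_)
  open import Data.Product using (_×_; _,_; proj₂)
  open import Data.Rational as ℚ using (toℚᵘ)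
  import Data.Rational.Properties as ℚₚ
  open import Data.Rational.Unnormalised as ℚᵘ using (mkℚᵘ; *≡*; *≤*)
  import Data.Rational.Unnormalised.Properties as ℚᵘₚ
  open import Function using (_∘_)

  -- Finite integer sums over lists.

  sumℤ : ∀ {A : Set} → (A → ℤ) → List A → ℤ
  sumℤ f []       = + 0
  sumℤ f (x ∷ xs) = f x + sumℤ f xs

  module _ {A : Set} where

    -- Agreement is asked only on members, since `total-rec` needs the length bound that membership
    -- in `cores n` provides.
    sumℤ-cong : ∀ {f g : A → ℤ} xs → (∀ {x} → x ∈ xs → f x ≡ g x) → sumℤ f xs ≡ sumℤ g xs
    sumℤ-cong []       eq = refl
    sumℤ-cong (x ∷ xs) eq = cong₂ _+_ (eq (here refl)) (sumℤ-cong xs (eq ∘ there))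

    sumℤ-++ : ∀ (f : A → ℤ) xs ys → sumℤ f (xs ++ ys) ≡ sumℤ f xs + sumℤ f ys
    sumℤ-++ f []       ys = sym (ℤₚ.+-identityˡ _)
    sumℤ-++ f (x ∷ xs) ys = trans (cong (_+_ (f x)) (sumℤ-++ f xs ys)) (sym (ℤₚ.+-assoc (f x) _ _))

    sumℤ-map : ∀ {B : Set} (f : B → ℤ) (h : A → B) xs → sumℤ f (map h xs) ≡ sumℤ (f ∘ h) xs
    sumℤ-map f h []       = refl
    sumℤ-map f h (x ∷ xs) = cong (_+_ (f (h x))) (sumℤ-map f h xs)

    sumℤ-+ : ∀ (f g : A → ℤ) xs → sumℤ (λ x → f x + g x) xs ≡ sumℤ f xs + sumℤ g xs
    sumℤ-+ f g []       = refl
    sumℤ-+ f g (x ∷ xs) = trans (cong (_+_ (f x + g x)) (sumℤ-+ f g xs))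
      (solve 4 (λ a b c d → (a :+ b) :+ (c :+ d) := (a :+ c) :+ (b :+ d)) refl
        (f x) (g x) (sumℤ f xs) (sumℤ g xs))

    sumℤ-*ˡ : ∀ c (f : A → ℤ) xs → sumℤ (λ x → c * f x) xs ≡ c * sumℤ f xs
    sumℤ-*ˡ c f []       = sym (ℤₚ.*-zeroʳ c)
    sumℤ-*ˡ c f (x ∷ xs) = trans (cong (_+_ (c * f x)) (sumℤ-*ˡ c f xs))
      (sym (ℤₚ.*-distribˡ-+ c (f x) (sumℤ f xs)))

    sumℤ-pos : ∀ (f : A → ℕ) xs → sumℤ (+_ ∘ f) xs ≡ + sum (map f xs)
    sumℤ-pos f []       = refl
    sumℤ-pos f (x ∷ xs) = cong (_+_ (+ f x)) (sumℤ-pos f xs)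

    sumℤ-const : ∀ c (xs : List A) → sumℤ (λ _ → c) xs ≡ + length xs * c
    sumℤ-const c []       = refl
    sumℤ-const c (x ∷ xs) = trans (cong (_+_ c) (sumℤ-const c xs)) (sym (ℤₚ.suc-* (+ length xs) c))

    sumℤ-mono : ∀ {f g : A → ℤ} xs → (∀ {x} → x ∈ xs → f x ℤ.≤ g x) →
      sumℤ f xs ℤ.≤ sumℤ g xs
    sumℤ-mono []       le = ℤₚ.≤-refl
    sumℤ-mono (x ∷ xs) le = ℤₚ.+-mono-≤ (le (here refl)) (sumℤ-mono xs (le ∘ there))

  -- Recursion for the sums of monomials in length and size.

  -- Monomials in ℓ, the length of a partition, and s, its size.
  data Monomial : Set where
    `1 `ℓ `s `ℓℓ `ℓs `ss : Monomial

  ⟦_⟧ : Monomial → ℤ → ℤ → ℤ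
  ⟦ `1  ⟧ ℓ s = + 1
  ⟦ `ℓ  ⟧ ℓ s = ℓ
  ⟦ `s  ⟧ ℓ s = s
  ⟦ `ℓℓ ⟧ ℓ s = ℓ * ℓ
  ⟦ `ℓs ⟧ ℓ s = ℓ * s
  ⟦ `ss ⟧ ℓ s = s * s

  -- A copy of `⟦_⟧` in the syntax of the ring solver, so that one coefficient table serves both a
  -- statement and its reflective proof; likewise `Σᴾ`, `hornerᴾ` and `combᴾ`.
  ⟦_⟧ᴾ : Monomial → ∀ {k} → Polynomial k → Polynomial k → Polynomial k
  ⟦ `1  ⟧ᴾ ℓ s = con (+ 1)
  ⟦ `ℓ  ⟧ᴾ ℓ s = ℓ
  ⟦ `s  ⟧ᴾ ℓ s = s
  ⟦ `ℓℓ ⟧ᴾ ℓ s = ℓ :* ℓ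
  ⟦ `ℓs ⟧ᴾ ℓ s = ℓ :* s
  ⟦ `ss ⟧ᴾ ℓ s = s :* s

  Σᴹ : (Monomial → ℤ) → ℤ
  Σᴹ g = g `1 + (g `ℓ + (g `s + (g `ℓℓ + (g `ℓs + g `ss))))

  Σᴾ : ∀ {k} → (Monomial → Polynomial k) → Polynomial k
  Σᴾ g = g `1 :+ (g `ℓ :+ (g `s :+ (g `ℓℓ :+ (g `ℓs :+ g `ss))))

  Σᴹ-cong : ∀ {f g} → (∀ μ → f μ ≡ g μ) → Σᴹ f ≡ Σᴹ g
  Σᴹ-cong eq = cong₂ _+_ (eq `1) (cong₂ _+_ (eq `ℓ) (cong₂ _+_ (eq `s)
    (cong₂ _+_ (eq `ℓℓ) (cong₂ _+_ (eq `ℓs) (eq `ss)))))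

  *-distribˡ-Σᴹ : ∀ c g → c * Σᴹ g ≡ Σᴹ (λ μ → c * g μ)
  *-distribˡ-Σᴹ c g = solve 7
    (λ c g₁ g₂ g₃ g₄ g₅ g₆ → c :* (g₁ :+ (g₂ :+ (g₃ :+ (g₄ :+ (g₅ :+ g₆)))))
      := c :* g₁ :+ (c :* g₂ :+ (c :* g₃ :+ (c :* g₄ :+ (c :* g₅ :+ c :* g₆)))))
    refl c (g `1) (g `ℓ) (g `s) (g `ℓℓ) (g `ℓs) (g `ss)

  stat : (ℤ → ℤ → ℤ) → List ℕ → ℤ
  stat f λs = f (+ length λs) (+ size λs)

  total : (ℤ → ℤ → ℤ) → ℕ → ℤ
  total f n = sumℤ (stat f) (cores n)

  total-cong : ∀ {f g} n → (∀ ℓ s → f ℓ s ≡ g ℓ s) → total f n ≡ total g n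
  total-cong n eq = sumℤ-cong (cores n) (λ _ → eq _ _)

  total-Σᴹ : ∀ (c : Monomial → ℤ) n →
    total (λ ℓ s → Σᴹ (λ μ → c μ * ⟦ μ ⟧ ℓ s)) n ≡ Σᴹ (λ μ → c μ * total ⟦ μ ⟧ n)
  total-Σᴹ c n = trans (split (t `1) _) (cong₂ _+_ (scale `1) (trans (split (t `ℓ) _)
    (cong₂ _+_ (scale `ℓ) (trans (split (t `s) _) (cong₂ _+_ (scale `s) (trans (split (t `ℓℓ) _)
    (cong₂ _+_ (scale `ℓℓ) (trans (split (t `ℓs) _) (cong₂ _+_ (scale `ℓs) (scale `ss))))))))))
    where
    t : Monomial → List ℕ → ℤ
    t μ = stat (λ ℓ s → c μ * ⟦ μ ⟧ ℓ s)
    split : ∀ (f g : List ℕ → ℤ) → sumℤ (λ λs → f λs + g λs) (cores n) ≡ sumℤ f (cores n) + sumℤ g (cores n)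
    split f g = sumℤ-+ f g (cores n)
    scale : ∀ μ → sumℤ (t μ) (cores n) ≡ c μ * total ⟦ μ ⟧ n
    scale μ = sumℤ-*ˡ (c μ) (stat ⟦ μ ⟧) (cores n)

  -- Prefixing the part n + 1 - ℓ raises the length by one and the size by that part.
  total-rec : ∀ f n → total f (2 ℕ.+ n) ≡
    total f (1 ℕ.+ n) + total (λ ℓ s → f (+ 1 + ℓ) ((+ 1 + + n - ℓ) + s)) n
  total-rec f n = trans (sumℤ-++ (stat f) (cores (suc n)) _) (cong (_+_ (total f (suc n)))
    (trans (sumℤ-map (stat f) (extend n) (cores n)) (sumℤ-cong (cores n) shift)))
    where
    shift : ∀ {λs} → λs ∈ cores n → stat f (extend n λs) ≡
      stat (λ ℓ s → f (+ 1 + ℓ) ((+ 1 + + n - ℓ) + s)) λs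
    -- Members of `cores n` have length at most n, so truncated and integer subtraction agree.
    shift {λs} i = cong (λ h → f (+ 1 + + length λs) (h + + size λs))
      (sym (trans (ℤₚ.m-n≡m⊖n (suc n) (length λs))
        (ℤₚ.⊖-≥ (ℕₚ.m≤n⇒m≤1+n (length≤semiperimeter λs (proj₂ (∈cores⇒ n i)))))))

  -- Polynomials in n are given by their coefficients, in ascending order.
  horner : List ℤ → ℤ → ℤ
  horner []       N = + 0
  horner (c ∷ cs) N = c + N * horner cs N

  hornerᴾ : ∀ {k} → List ℤ → Polynomial k → Polynomial k
  hornerᴾ []       N = con (+ 0)
  hornerᴾ (c ∷ cs) N = con c :+ N :* hornerᴾ cs N

  -- How a monomial changes when the part n + 1 − ℓ is added.
  shift : Monomial → Monomial → List ℤ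
  shift `1  `1  = + 1 ∷ []
  shift `ℓ  `1  = + 1 ∷ []
  shift `ℓ  `ℓ  = + 1 ∷ []
  shift `s  `1  = + 1 ∷ + 1 ∷ []
  shift `s  `ℓ  = - + 1 ∷ []
  shift `s  `s  = + 1 ∷ []
  shift `ℓℓ `1  = + 1 ∷ []
  shift `ℓℓ `ℓ  = + 2 ∷ []
  shift `ℓℓ `ℓℓ = + 1 ∷ []
  shift `ℓs `1  = + 1 ∷ + 1 ∷ []
  shift `ℓs `ℓ  = + 0 ∷ + 1 ∷ []
  shift `ℓs `s  = + 1 ∷ []
  shift `ℓs `ℓℓ = - + 1 ∷ []
  shift `ℓs `ℓs = + 1 ∷ []
  shift `ss `1  = + 1 ∷ + 2 ∷ + 1 ∷ []
  shift `ss `ℓ  = - + 2 ∷ - + 2 ∷ []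
  shift `ss `s  = + 2 ∷ + 2 ∷ []
  shift `ss `ℓℓ = + 1 ∷ []
  shift `ss `ℓs = - + 2 ∷ []
  shift `ss `ss = + 1 ∷ []
  shift _   _   = []

  shift-equation : Monomial → Polynomial 3 → Polynomial 3 → Polynomial 3 → Polynomial 3 × Polynomial 3
  shift-equation μ N ℓ s = ⟦ μ ⟧ᴾ (con (+ 1) :+ ℓ) ((con (+ 1) :+ N :- ℓ) :+ s)
    := Σᴾ (λ ν → hornerᴾ (shift μ ν) N :* ⟦ ν ⟧ᴾ ℓ s)

  -- The substitution is affine in ℓ and s, so it preserves the span of the six monomials of degree
  -- at most two; the recursion closes up on their totals.
  shift-correct : ∀ μ N ℓ s →
    ⟦ μ ⟧ (+ 1 + ℓ) ((+ 1 + N - ℓ) + s) ≡ Σᴹ (λ ν → horner (shift μ ν) N * ⟦ ν ⟧ ℓ s)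
  shift-correct `1  = solve 3 (shift-equation `1) refl
  shift-correct `ℓ  = solve 3 (shift-equation `ℓ) refl
  shift-correct `s  = solve 3 (shift-equation `s) refl
  shift-correct `ℓℓ = solve 3 (shift-equation `ℓℓ) refl
  shift-correct `ℓs = solve 3 (shift-equation `ℓs) refl
  shift-correct `ss = solve 3 (shift-equation `ss) refl

  total-step : ∀ μ n → total ⟦ μ ⟧ (2 ℕ.+ n) ≡
    total ⟦ μ ⟧ (1 ℕ.+ n) + Σᴹ (λ ν → horner (shift μ ν) (+ n) * total ⟦ ν ⟧ n)
  total-step μ n = trans (total-rec ⟦ μ ⟧ n) (cong (_+_ (total ⟦ μ ⟧ (suc n)))
    (trans (total-cong n (shift-correct μ (+ n))) (total-Σᴹ (λ ν → horner (shift μ ν) (+ n)) n)))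

  -- Closed forms in n and two consecutive counts.

  -- With u the number of cores for n and v that for n + 1, the sum of a monomial over the cores
  -- is (pᵤ(n) u + qᵥ(n) v) / 1500; the coefficients were found by fitting.
  pᵤ qᵥ : Monomial → List ℤ
  pᵤ `1  = + 1500 ∷ []
  pᵤ `ℓ  = + 300 ∷ + 900 ∷ []
  pᵤ `s  = + 180 ∷ + 390 ∷ + 150 ∷ []
  pᵤ `ℓℓ = - + 60 ∷ + 420 ∷ + 600 ∷ []
  pᵤ `ℓs = + 0 ∷ + 300 ∷ + 330 ∷ + 90 ∷ []
  pᵤ `ss = + 36 ∷ + 128 ∷ + 135 ∷ + 70 ∷ + 15 ∷ []
  qᵥ `1  = []
  qᵥ `ℓ  = - + 300 ∷ - + 300 ∷ []
  qᵥ `s  = - + 180 ∷ - + 180 ∷ []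
  qᵥ `ℓℓ = + 60 ∷ - + 240 ∷ - + 300 ∷ []
  qᵥ `ℓs = + 0 ∷ - + 150 ∷ - + 180 ∷ - + 30 ∷ []
  qᵥ `ss = - + 36 ∷ - + 76 ∷ - + 60 ∷ - + 20 ∷ []

  comb : List ℤ → List ℤ → ℤ → ℤ → ℤ → ℤ
  comb ps qs N u v = horner ps N * u + horner qs N * v

  combᴾ : ∀ {k} → List ℤ → List ℤ → Polynomial k → Polynomial k → Polynomial k → Polynomial k
  combᴾ ps qs N u v = hornerᴾ ps N :* u :+ hornerᴾ qs N :* v

  comb-equation : Monomial → Polynomial 3 → Polynomial 3 → Polynomial 3 → Polynomial 3 × Polynomial 3
  comb-equation μ N u v =
    combᴾ (pᵤ μ) (qᵥ μ) (con (+ 1) :+ N) v (v :+ u)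
      :+ Σᴾ (λ ν → hornerᴾ (shift μ ν) N :* combᴾ (pᵤ ν) (qᵥ ν) N u v)
    := combᴾ (pᵤ μ) (qᵥ μ) (con (+ 2) :+ N) (v :+ u) ((v :+ u) :+ v)

  -- The induction step of `total-closed` as a polynomial identity: the counts after u and v are v +
  -- u and (v + u) + v.
  comb-step : ∀ μ N u v →
    comb (pᵤ μ) (qᵥ μ) (+ 1 + N) v (v + u)
      + Σᴹ (λ ν → horner (shift μ ν) N * comb (pᵤ ν) (qᵥ ν) N u v)
    ≡ comb (pᵤ μ) (qᵥ μ) (+ 2 + N) (v + u) ((v + u) + v)
  comb-step `1  = solve 3 (comb-equation `1) refl
  comb-step `ℓ  = solve 3 (comb-equation `ℓ) refl
  comb-step `s  = solve 3 (comb-equation `s) refl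
  comb-step `ℓℓ = solve 3 (comb-equation `ℓℓ) refl
  comb-step `ℓs = solve 3 (comb-equation `ℓs) refl
  comb-step `ss = solve 3 (comb-equation `ss) refl

  count : ℕ → ℕ
  count n = length (cores n)

  count-rec : ∀ n → count (2 ℕ.+ n) ≡ count (1 ℕ.+ n) ℕ.+ count n
  count-rec n = trans (Listₚ.length-++ (cores (suc n)))
    (cong (ℕ._+_ (count (suc n))) (Listₚ.length-map (extend n) (cores n)))

  -- The closed form is a hypothesis here, so that the lemma serves inside the induction of
  -- `total-closed` as well as after it.
  scaled-total : ∀ (c : Monomial → List ℤ) n →
    (∀ μ → + 1500 * total ⟦ μ ⟧ n ≡ comb (pᵤ μ) (qᵥ μ) (+ n) (+ count n) (+ count (1 ℕ.+ n))) → ∀ μ →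
    + 1500 * (horner (c μ) (+ n) * total ⟦ μ ⟧ n)
      ≡ horner (c μ) (+ n) * comb (pᵤ μ) (qᵥ μ) (+ n) (+ count n) (+ count (1 ℕ.+ n))
  scaled-total c n closed μ = trans
    (solve 3 (λ a b c → a :* (b :* c) := b :* (a :* c)) refl (+ 1500) (horner (c μ) (+ n)) (total ⟦ μ ⟧ n))
    (cong (horner (c μ) (+ n) *_) (closed μ))

  -- Two-step induction along the Fibonacci recursion. The factor 1500 is the common denominator of
  -- the coefficients.
  total-closed : ∀ n μ →
    + 1500 * total ⟦ μ ⟧ n ≡ comb (pᵤ μ) (qᵥ μ) (+ n) (+ count n) (+ count (1 ℕ.+ n))
  total-closed zero `1  = refl
  total-closed zero `ℓ  = refl
  total-closed zero `s  = refl
  total-closed zero `ℓℓ = refl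
  total-closed zero `ℓs = refl
  total-closed zero `ss = refl
  total-closed (suc zero) `1  = refl
  total-closed (suc zero) `ℓ  = refl
  total-closed (suc zero) `s  = refl
  total-closed (suc zero) `ℓℓ = refl
  total-closed (suc zero) `ℓs = refl
  total-closed (suc zero) `ss = refl
  total-closed (suc (suc n)) μ = begin
    + 1500 * total ⟦ μ ⟧ (2 ℕ.+ n)
      ≡⟨ cong (+ 1500 *_) (total-step μ n) ⟩
    + 1500 * (total ⟦ μ ⟧ (1 ℕ.+ n) + Σᴹ (λ ν → horner (shift μ ν) (+ n) * total ⟦ ν ⟧ n))
      ≡⟨ ℤₚ.*-distribˡ-+ (+ 1500) (total ⟦ μ ⟧ (1 ℕ.+ n)) _ ⟩
    + 1500 * total ⟦ μ ⟧ (1 ℕ.+ n)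
      + + 1500 * Σᴹ (λ ν → horner (shift μ ν) (+ n) * total ⟦ ν ⟧ n)
      ≡⟨ cong₂ _+_ ih₁ (trans
           (*-distribˡ-Σᴹ (+ 1500) (λ ν → horner (shift μ ν) (+ n) * total ⟦ ν ⟧ n)) (Σᴹ-cong ih₀)) ⟩
    comb (pᵤ μ) (qᵥ μ) (+ 1 + + n) v (v + u)
      + Σᴹ (λ ν → horner (shift μ ν) (+ n) * comb (pᵤ ν) (qᵥ ν) (+ n) u v)
      ≡⟨ comb-step μ (+ n) u v ⟩
    comb (pᵤ μ) (qᵥ μ) (+ 2 + + n) (v + u) ((v + u) + v)
      ≡⟨ cong₂ (comb (pᵤ μ) (qᵥ μ) (+ 2 + + n)) (cong +_ (sym (count-rec n)))
           (cong +_ (sym (trans (count-rec (suc n)) (cong (ℕ._+ count (suc n)) (count-rec n))))) ⟩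
    comb (pᵤ μ) (qᵥ μ) (+ 2 + + n) (+ count (2 ℕ.+ n)) (+ count (3 ℕ.+ n)) ∎
    where
    open ≡-Reasoning
    u = + count n
    v = + count (suc n)
    ih₁ = trans (total-closed (suc n) μ)
      (cong (λ w → comb (pᵤ μ) (qᵥ μ) (+ suc n) v (+ w)) (count-rec n))
    ih₀ : ∀ ν → + 1500 * (horner (shift μ ν) (+ n) * total ⟦ ν ⟧ n)
      ≡ horner (shift μ ν) (+ n) * comb (pᵤ ν) (qᵥ ν) (+ n) u v
    ih₀ = scaled-total (shift μ) n (total-closed n)

  total-Σᴹ-closed : ∀ (c : Monomial → List ℤ) n →
    + 1500 * total (λ ℓ s → Σᴹ (λ μ → horner (c μ) (+ n) * ⟦ μ ⟧ ℓ s)) n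
      ≡ Σᴹ (λ μ → horner (c μ) (+ n) * comb (pᵤ μ) (qᵥ μ) (+ n) (+ count n) (+ count (1 ℕ.+ n)))
  total-Σᴹ-closed c n = trans (cong (+ 1500 *_) (total-Σᴹ (λ μ → horner (c μ) (+ n)) n))
    (trans (*-distribˡ-Σᴹ (+ 1500) (λ μ → horner (c μ) (+ n) * total ⟦ μ ⟧ n))
      (Σᴹ-cong (scaled-total c n (total-closed n))))

  -- First and second moments of 10 s - n².

  deviation : ℕ → ℤ → ℤ
  deviation n s = + 10 * s - + n * + n

  -- The quadratic coefficient cancels: 10 · 150 - 1500 = 0.
  total-deviation : ∀ n → + 1500 * total (λ _ s → deviation n s) n
    ≡ comb (+ 1800 ∷ + 3900 ∷ []) (- + 1800 ∷ - + 1800 ∷ []) (+ n) (+ count n) (+ count (1 ℕ.+ n))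
  total-deviation n = trans (cong (+ 1500 *_) (total-cong n expand)) (trans (total-Σᴹ-closed c n)
    (solve 3 (λ N u v → Σᴾ (λ μ → hornerᴾ (c μ) N :* combᴾ (pᵤ μ) (qᵥ μ) N u v)
        := combᴾ (+ 1800 ∷ + 3900 ∷ []) (- + 1800 ∷ - + 1800 ∷ []) N u v)
      refl (+ n) (+ count n) (+ count (1 ℕ.+ n))))
    where
    c : Monomial → List ℤ
    c `1 = + 0 ∷ + 0 ∷ - + 1 ∷ []
    c `s = + 10 ∷ []
    c _  = []
    expand : ∀ ℓ s → deviation n s ≡ Σᴹ (λ μ → horner (c μ) (+ n) * ⟦ μ ⟧ ℓ s)
    expand = solve 3 (λ N ℓ s → con (+ 10) :* s :- N :* N
      := Σᴾ (λ μ → hornerᴾ (c μ) N :* ⟦ μ ⟧ᴾ ℓ s)) refl (+ n)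

  -- The quartic coefficient cancels: 100 · 15 - 20 · 150 + 1500 = 0.
  total-deviation² : ∀ n → + 1500 * total (λ _ s → deviation n s * deviation n s) n
    ≡ comb (+ 3600 ∷ + 12800 ∷ + 9900 ∷ - + 800 ∷ []) (- + 3600 ∷ - + 7600 ∷ - + 2400 ∷ + 1600 ∷ [])
        (+ n) (+ count n) (+ count (1 ℕ.+ n))
  total-deviation² n = trans (cong (+ 1500 *_) (total-cong n expand)) (trans (total-Σᴹ-closed c n)
    (solve 3 (λ N u v → Σᴾ (λ μ → hornerᴾ (c μ) N :* combᴾ (pᵤ μ) (qᵥ μ) N u v)
        := combᴾ (+ 3600 ∷ + 12800 ∷ + 9900 ∷ - + 800 ∷ [])
             (- + 3600 ∷ - + 7600 ∷ - + 2400 ∷ + 1600 ∷ []) N u v)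
      refl (+ n) (+ count n) (+ count (1 ℕ.+ n))))
    where
    c : Monomial → List ℤ
    c `1  = + 0 ∷ + 0 ∷ + 0 ∷ + 0 ∷ + 1 ∷ []
    c `s  = + 0 ∷ + 0 ∷ - + 20 ∷ []
    c `ss = + 100 ∷ []
    c _   = []
    expand : ∀ ℓ s → deviation n s * deviation n s ≡ Σᴹ (λ μ → horner (c μ) (+ n) * ⟦ μ ⟧ ℓ s)
    expand = solve 3 (λ N ℓ s → (con (+ 10) :* s :- N :* N) :* (con (+ 10) :* s :- N :* N)
      := Σᴾ (λ μ → hornerᴾ (c μ) N :* ⟦ μ ⟧ᴾ ℓ s)) refl (+ n)

  -- Growth estimates for the moments.

  weight : List ℤ → ℕ
  weight cs = sum (map ∣_∣ cs)

  -- For n at least 1, every power of n up to the d-th is at most `n ^ d`.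
  ∣horner∣≤ : ∀ {n} → 0 ℕ.< n → ∀ cs d → length cs ℕ.≤ suc d →
    ∣ horner cs (+ n) ∣ ℕ.≤ weight cs ℕ.* n ^ d
  ∣horner∣≤ 0<n []       d _ = z≤n
  ∣horner∣≤ {n@(suc _)} 0<n (c ∷ []) d _ = begin
    ∣ c + + n * + 0 ∣       ≡⟨ cong (λ z → ∣ c + z ∣) (ℤₚ.*-zeroʳ (+ n)) ⟩
    ∣ c + + 0 ∣             ≡⟨ cong ∣_∣ (ℤₚ.+-identityʳ c) ⟩
    ∣ c ∣                   ≤⟨ ℕₚ.m≤m*n ∣ c ∣ (n ^ d) {{ℕₚ.m^n≢0 n d}} ⟩
    ∣ c ∣ ℕ.* n ^ d         ≡⟨ cong (ℕ._* n ^ d) (ℕₚ.+-identityʳ ∣ c ∣) ⟨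
    (∣ c ∣ ℕ.+ 0) ℕ.* n ^ d ∎
    where open ℕₚ.≤-Reasoning
  ∣horner∣≤ {n@(suc _)} 0<n (c ∷ cs@(_ ∷ _)) (suc d) (s≤s len) = begin
    ∣ c + + n * horner cs (+ n) ∣
      ≤⟨ ℤₚ.∣i+j∣≤∣i∣+∣j∣ c _ ⟩
    ∣ c ∣ ℕ.+ ∣ + n * horner cs (+ n) ∣
      ≡⟨ cong (ℕ._+_ ∣ c ∣) (ℤₚ.abs-* (+ n) (horner cs (+ n))) ⟩
    ∣ c ∣ ℕ.+ n ℕ.* ∣ horner cs (+ n) ∣
      ≤⟨ ℕₚ.+-mono-≤ (ℕₚ.m≤m*n ∣ c ∣ (n ^ suc d) {{ℕₚ.m^n≢0 n (suc d)}})
           (ℕₚ.*-monoʳ-≤ n (∣horner∣≤ 0<n cs d len)) ⟩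
    ∣ c ∣ ℕ.* n ^ suc d ℕ.+ n ℕ.* (weight cs ℕ.* n ^ d)
      ≡⟨ cong (ℕ._+_ (∣ c ∣ ℕ.* n ^ suc d)) (ℕ*-left-comm n (weight cs) (n ^ d)) ⟩
    ∣ c ∣ ℕ.* n ^ suc d ℕ.+ weight cs ℕ.* n ^ suc d
      ≡⟨ ℕₚ.*-distribʳ-+ (n ^ suc d) ∣ c ∣ (weight cs) ⟨
    weight (c ∷ cs) ℕ.* n ^ suc d ∎
    where
    open ℕₚ.≤-Reasoning
    ℕ*-left-comm : ∀ a b c → a ℕ.* (b ℕ.* c) ≡ b ℕ.* (a ℕ.* c)
    ℕ*-left-comm a b c = trans (sym (ℕₚ.*-assoc a b c))
      (trans (cong (ℕ._* c) (ℕₚ.*-comm a b)) (ℕₚ.*-assoc b a c))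

  count-mono : ∀ n → count n ℕ.≤ count (suc n)
  count-mono zero    = s≤s z≤n
  count-mono (suc n) = subst (count (suc n) ℕ.≤_) (sym (count-rec n)) (ℕₚ.m≤m+n _ _)

  -- Lets a bound in two consecutive counts be stated through `count n` alone.
  count-suc≤ : ∀ n → count (suc n) ℕ.≤ 2 ℕ.* count n
  count-suc≤ zero    = s≤s z≤n
  count-suc≤ (suc n) = subst (ℕ._≤ 2 ℕ.* count (suc n)) (sym (count-rec n))
    (ℕₚ.+-monoʳ-≤ (count (suc n)) (ℕₚ.≤-trans (count-mono n) (ℕₚ.m≤m+n _ 0)))

  count-pos : ∀ n → 0 ℕ.< count n
  count-pos zero    = s≤s z≤n
  count-pos (suc n) = ℕₚ.<-≤-trans (count-pos n) (count-mono n)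

  ∣comb∣≤ : ∀ {n} → 0 ℕ.< n → ∀ ps qs d → length ps ℕ.≤ suc d → length qs ℕ.≤ suc d →
    ∣ comb ps qs (+ n) (+ count n) (+ count (suc n)) ∣
      ℕ.≤ (weight ps ℕ.+ 2 ℕ.* weight qs) ℕ.* (n ^ d ℕ.* count n)
  ∣comb∣≤ {n} 0<n ps qs d lp lq = begin
    ∣ P * + a + Q * + b ∣
      ≤⟨ ℤₚ.∣i+j∣≤∣i∣+∣j∣ (P * + a) (Q * + b) ⟩
    ∣ P * + a ∣ ℕ.+ ∣ Q * + b ∣
      ≡⟨ cong₂ ℕ._+_ (ℤₚ.abs-* P (+ a)) (ℤₚ.abs-* Q (+ b)) ⟩
    ∣ P ∣ ℕ.* a ℕ.+ ∣ Q ∣ ℕ.* b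
      ≤⟨ ℕₚ.+-mono-≤ (ℕₚ.*-monoˡ-≤ a (∣horner∣≤ 0<n ps d lp))
           (ℕₚ.*-mono-≤ (∣horner∣≤ 0<n qs d lq) (count-suc≤ n)) ⟩
    weight ps ℕ.* n ^ d ℕ.* a ℕ.+ weight qs ℕ.* n ^ d ℕ.* (2 ℕ.* a)
      ≡⟨ ℕ-solve 4 (λ x y z a → x ⊗ z ⊗ a ⊕ y ⊗ z ⊗ (κ 2 ⊗ a) ⊜ (x ⊕ κ 2 ⊗ y) ⊗ (z ⊗ a))
           refl (weight ps) (weight qs) (n ^ d) a ⟩
    (weight ps ℕ.+ 2 ℕ.* weight qs) ℕ.* (n ^ d ℕ.* a) ∎
    where
    open ℕₚ.≤-Reasoning
    a = count n
    b = count (suc n)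
    P = horner ps (+ n)
    Q = horner qs (+ n)

  ∣i∣≤∣1500*i∣ : ∀ {i j} → + 1500 * i ≡ j → ∣ i ∣ ℕ.≤ ∣ j ∣
  ∣i∣≤∣1500*i∣ {i} refl = subst (∣ i ∣ ℕ.≤_) (sym (ℤₚ.abs-* (+ 1500) i)) (ℕₚ.m≤n*m ∣ i ∣ 1500)

  -- The constant is 5700 + 2 · 3600, from the weights of the two coefficient lists; the factor 1500
  -- is simply dropped.
  ∣total-deviation∣≤ : ∀ {n} → 0 ℕ.< n →
    ∣ total (λ _ s → deviation n s) n ∣ ℕ.≤ 12900 ℕ.* (n ^ 1 ℕ.* count n)
  ∣total-deviation∣≤ {n} 0<n = ℕₚ.≤-trans (∣i∣≤∣1500*i∣ (total-deviation n))
    (∣comb∣≤ 0<n (+ 1800 ∷ + 3900 ∷ []) (- + 1800 ∷ - + 1800 ∷ []) 1 ℕₚ.≤-refl ℕₚ.≤-refl)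

  -- Here the constant is 27100 + 2 · 15200.
  ∣total-deviation²∣≤ : ∀ {n} → 0 ℕ.< n →
    ∣ total (λ _ s → deviation n s * deviation n s) n ∣ ℕ.≤ 57500 ℕ.* (n ^ 3 ℕ.* count n)
  ∣total-deviation²∣≤ {n} 0<n = ℕₚ.≤-trans (∣i∣≤∣1500*i∣ (total-deviation² n))
    (∣comb∣≤ 0<n (+ 3600 ∷ + 12800 ∷ + 9900 ∷ - + 800 ∷ [])
      (- + 3600 ∷ - + 7600 ∷ - + 2400 ∷ + 1600 ∷ []) 3 ℕₚ.≤-refl ℕₚ.≤-refl)

  -- First-order Taylor expansion of powers.

  remainder : ℕ → ℕ → ℕ → ℕ
  remainder x y zero    = 0
  remainder x y (suc j) = x ℕ.* remainder x y j ℕ.+ suc j ℕ.* y ^ j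

  -- Multiplying the expansion by x = y + d moves one more multiple of d² into the remainder, which
  -- gives the recursion of `remainder`.
  taylor : ∀ x y j → let d = + x - + y in
    + (x ^ suc j) ≡ + (y ^ suc j) + + (suc j ℕ.* y ^ j) * d + d * d * + remainder x y j
  taylor x y zero = trans (cong +_ (ℕₚ.*-identityʳ x)) (trans
    (solve 2 (λ x y → x := y :+ con (+ 1) :* (x :- y) :+ (x :- y) :* (x :- y) :* con (+ 0)) refl (+ x) (+ y))
    (cong (λ z → + z + + 1 * (+ x - + y) + (+ x - + y) * (+ x - + y) * + 0) (sym (ℕₚ.*-identityʳ y))))
  taylor x y (suc j) = begin
    + (x ℕ.* x ^ suc j)
      ≡⟨ ℤₚ.pos-* x (x ^ suc j) ⟩
    + x * + (x ^ suc j)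
      ≡⟨ cong (+ x *_) (taylor x y j) ⟩
    + x * (+ (y ^ suc j) + + (suc j ℕ.* y ^ j) * d + d * d * + r)
      ≡⟨ cong₂ (λ a b → + x * (a + b * d + d * d * + r)) (ℤₚ.pos-* y (y ^ j)) (ℤₚ.pos-* (suc j) (y ^ j)) ⟩
    + x * (+ y * + (y ^ j) + + suc j * + (y ^ j) * d + d * d * + r)
      ≡⟨ solve 5 (λ x y p j r → let d = x :- y ; j₁ = con (+ 1) :+ j in
           x :* (y :* p :+ j₁ :* p :* d :+ d :* d :* r)
             := y :* (y :* p) :+ (con (+ 1) :+ j₁) :* (y :* p) :* d :+ d :* d :* (x :* r :+ j₁ :* p))
           refl (+ x) (+ y) (+ (y ^ j)) (+ j) (+ r) ⟩
    + y * (+ y * + (y ^ j)) + + suc (suc j) * (+ y * + (y ^ j)) * d + d * d * (+ x * + r + + suc j * + (y ^ j))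
      ≡⟨ cong₂ (λ a b → + y * a + + suc (suc j) * a * d + d * d * b)
           (sym (ℤₚ.pos-* y (y ^ j)))
           (cong₂ _+_ (sym (ℤₚ.pos-* x r)) (sym (ℤₚ.pos-* (suc j) (y ^ j)))) ⟩
    + y * + (y ^ suc j) + + suc (suc j) * + (y ^ suc j) * d + d * d * + remainder x y (suc j)
      ≡⟨ cong₂ (λ a b → a + b * d + d * d * + remainder x y (suc j))
           (sym (ℤₚ.pos-* y (y ^ suc j))) (sym (ℤₚ.pos-* (suc (suc j)) (y ^ suc j))) ⟩
    + (y ^ suc (suc j)) + + (suc (suc j) ℕ.* y ^ suc j) * d + d * d * + remainder x y (suc j) ∎
    where
    open ≡-Reasoning
    d = + x - + y
    r = remainder x y j

  -- The value of `remainder 10 1 j`.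
  remainder-coeff : ℕ → ℕ
  remainder-coeff zero    = 0
  remainder-coeff (suc j) = 10 ℕ.* remainder-coeff j ℕ.+ suc j

  -- For positive j the remainder is homogeneous of degree j - 1 in x and y. The extra factor `y`
  -- avoids that exponent and covers j = 0.
  remainder≤ : ∀ {x y} → x ℕ.≤ 10 ℕ.* y → ∀ j →
    y ℕ.* remainder x y j ℕ.≤ remainder-coeff j ℕ.* y ^ j
  remainder≤ {x} {y} x≤ zero    = ℕₚ.≤-reflexive (ℕₚ.*-zeroʳ y)
  remainder≤ {x} {y} x≤ (suc j) = begin
    y ℕ.* (x ℕ.* r ℕ.+ suc j ℕ.* y ^ j)
      ≡⟨ ℕ-solve 5 (λ y x r j p → y ⊗ (x ⊗ r ⊕ j ⊗ p) ⊜ x ⊗ (y ⊗ r) ⊕ j ⊗ (y ⊗ p))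
           refl y x r (suc j) (y ^ j) ⟩
    x ℕ.* (y ℕ.* r) ℕ.+ suc j ℕ.* y ^ suc j
      ≤⟨ ℕₚ.+-monoˡ-≤ (suc j ℕ.* y ^ suc j) (ℕₚ.*-mono-≤ x≤ (remainder≤ x≤ j)) ⟩
    10 ℕ.* y ℕ.* (remainder-coeff j ℕ.* y ^ j) ℕ.+ suc j ℕ.* y ^ suc j
      ≡⟨ ℕ-solve 4 (λ y c j p → κ 10 ⊗ y ⊗ (c ⊗ p) ⊕ j ⊗ (y ⊗ p) ⊜ (κ 10 ⊗ c ⊕ j) ⊗ (y ⊗ p))
           refl y (remainder-coeff j) (suc j) (y ^ j) ⟩
    remainder-coeff (suc j) ℕ.* y ^ suc j ∎
    where
    open ℕₚ.≤-Reasoning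
    r = remainder x y j

  -- Power sums of the size.

  size≤ : ∀ {λs} → DistinctPartition λs → size λs ℕ.≤ length λs ℕ.* part λs 0
  size≤ {[]}     d = z≤n
  size≤ {x ∷ λs} d = let d′ , p = distinct-tail d in
    ℕₚ.+-monoʳ-≤ x (ℕₚ.≤-trans (size≤ d′) (ℕₚ.*-monoʳ-≤ (length λs) (ℕₚ.<⇒≤ p)))

  size-core≤ : ∀ n {λs} → λs ∈ cores n → size λs ℕ.≤ n ℕ.* n
  size-core≤ n {λs} i = let d , p = ∈cores⇒ n i in
    ℕₚ.≤-trans (size≤ d) (ℕₚ.*-mono-≤ (length≤semiperimeter λs p) (ℕₚ.≤-trans (ℕₚ.m≤m+n _ _) p))

  powerSum : ℕ → ℕ → ℕ
  powerSum k n = sum (map (λ λs → size λs ^ k) (cores n))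

  ^-distrib-* : ∀ a b k → (a ℕ.* b) ^ k ≡ a ^ k ℕ.* b ^ k
  ^-distrib-* a b zero    = refl
  ^-distrib-* a b (suc k) = trans (cong (a ℕ.* b ℕ.*_) (^-distrib-* a b k))
    (ℕₚ.[m*n]*[o*p]≡[m*o]*[n*p] a b (a ^ k) (b ^ k))

  -- The implied constant for k = j + 1: the linear Taylor term plus the remainder.
  bound-coeff : ℕ → ℕ
  bound-coeff j = 12900 ℕ.* suc j ℕ.+ 57500 ℕ.* remainder-coeff j

  module _ (j : ℕ) {n : ℕ} (0<n : 0 ℕ.< n) where

    private
      -- The expansion point is n², and `slope` is the derivative of the power j + 1 there.
      y = n ℕ.* n
      slope = suc j ℕ.* y ^ j
      C = remainder-coeff j

      dev : List ℕ → ℤ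
      dev λs = deviation n (+ size λs)

      x : List ℕ → ℕ
      x λs = 10 ℕ.* size λs

      rem : List ℕ → ℤ
      rem λs = dev λs * dev λs * + remainder (x λs) y j

      Δ Δ² R : ℤ
      Δ  = sumℤ dev (cores n)
      Δ² = sumℤ (λ λs → dev λs * dev λs) (cores n)
      R  = sumℤ rem (cores n)

      term : ∀ λs → + (10 ^ suc j) * + (size λs ^ suc j) ≡ (+ (y ^ suc j) + + slope * dev λs) + rem λs
      term λs = trans (sym (ℤₚ.pos-* (10 ^ suc j) (size λs ^ suc j)))
        (trans (cong +_ (sym (^-distrib-* 10 (size λs) (suc j))))
          (trans (taylor (x λs) y j)
            (cong (λ d → + (y ^ suc j) + + slope * d + d * d * + remainder (x λs) y j)
              (cong₂ _-_ (ℤₚ.pos-* 10 (size λs)) (ℤₚ.pos-* n n)))))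

      expansion : + (10 ^ suc j) * + powerSum (suc j) n ≡ (+ count n * + (y ^ suc j) + + slope * Δ) + R
      expansion = begin
        + (10 ^ suc j) * + powerSum (suc j) n
          ≡⟨ cong (+ (10 ^ suc j) *_) (sym (sumℤ-pos (λ λs → size λs ^ suc j) (cores n))) ⟩
        + (10 ^ suc j) * sumℤ (λ λs → + (size λs ^ suc j)) (cores n)
          ≡⟨ sumℤ-*ˡ (+ (10 ^ suc j)) (λ λs → + (size λs ^ suc j)) (cores n) ⟨
        sumℤ (λ λs → + (10 ^ suc j) * + (size λs ^ suc j)) (cores n)
          ≡⟨ sumℤ-cong (cores n) (λ {λs} _ → term λs) ⟩
        sumℤ (λ λs → (+ (y ^ suc j) + + slope * dev λs) + rem λs) (cores n)
          ≡⟨ sumℤ-+ (λ λs → + (y ^ suc j) + + slope * dev λs) rem (cores n) ⟩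
        sumℤ (λ λs → + (y ^ suc j) + + slope * dev λs) (cores n) + R
          ≡⟨ cong (_+ R) (sumℤ-+ (λ _ → + (y ^ suc j)) (λ λs → + slope * dev λs) (cores n)) ⟩
        sumℤ (λ _ → + (y ^ suc j)) (cores n) + sumℤ (λ λs → + slope * dev λs) (cores n) + R
          ≡⟨ cong (_+ R) (cong₂ _+_ (sumℤ-const (+ (y ^ suc j)) (cores n))
               (sumℤ-*ˡ (+ slope) dev (cores n))) ⟩
        + count n * + (y ^ suc j) + + slope * Δ + R ∎
        where open ≡-Reasoning

      square-nonNeg : ∀ i → ℤ.NonNegative (i * i)
      square-nonNeg (+ zero)   = _
      square-nonNeg (+ suc m)  = _
      square-nonNeg ℤ.-[1+ m ] = _

      -- Each remainder term is a square times a natural number. Hence R is its own absolute value,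
      -- and an upper bound suffices.
      R≥0 : + 0 ℤ.≤ R
      R≥0 = subst (ℤ._≤ R) (trans (sumℤ-const (+ 0) (cores n)) (ℤₚ.*-zeroʳ (+ count n)))
        (sumℤ-mono (cores n) (λ {λs} _ → subst (ℤ._≤ rem λs) (ℤₚ.*-zeroʳ (dev λs * dev λs))
          (ℤₚ.*-monoˡ-≤-nonNeg (dev λs * dev λs) {{square-nonNeg (dev λs)}} (ℤ.+≤+ z≤n))))

      y*R≤ : + y * R ℤ.≤ + (C ℕ.* y ^ j) * Δ²
      y*R≤ = subst₂ ℤ._≤_ (sumℤ-*ˡ (+ y) rem (cores n))
        (sumℤ-*ˡ (+ (C ℕ.* y ^ j)) (λ λs → dev λs * dev λs) (cores n))
        (sumℤ-mono (cores n) (λ {λs} i → bound λs i))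
        where
        bound : ∀ λs → λs ∈ cores n → + y * rem λs ℤ.≤ + (C ℕ.* y ^ j) * (dev λs * dev λs)
        bound λs i = begin
          + y * (D² * + r)
            ≡⟨ solve 3 (λ a b c → a :* (b :* c) := b :* (a :* c)) refl (+ y) D² (+ r) ⟩
          D² * (+ y * + r)
            ≡⟨ cong (D² *_) (sym (ℤₚ.pos-* y r)) ⟩
          D² * + (y ℕ.* r)
            ≤⟨ ℤₚ.*-monoˡ-≤-nonNeg D² {{square-nonNeg (dev λs)}}
                 (ℤ.+≤+ (remainder≤ (ℕₚ.*-monoʳ-≤ 10 (size-core≤ n i)) j)) ⟩
          D² * + (C ℕ.* y ^ j)
            ≡⟨ ℤₚ.*-comm D² _ ⟩
          + (C ℕ.* y ^ j) * D² ∎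
          where
          open ℤₚ.≤-Reasoning
          D² = dev λs * dev λs
          r = remainder (x λs) y j

      y∣R∣≤ : y ℕ.* ∣ R ∣ ℕ.≤ C ℕ.* y ^ j ℕ.* ∣ Δ² ∣
      y∣R∣≤ = ℤₚ.drop‿+≤+ (begin
        + (y ℕ.* ∣ R ∣)               ≡⟨ ℤₚ.pos-* y ∣ R ∣ ⟩
        + y * + ∣ R ∣                 ≡⟨ cong (+ y *_) (ℤₚ.0≤i⇒+∣i∣≡i R≥0) ⟩
        + y * R                       ≤⟨ y*R≤ ⟩
        + (C ℕ.* y ^ j) * Δ²          ≤⟨ ℤₚ.*-monoˡ-≤-nonNeg (+ (C ℕ.* y ^ j)) (i≤∣i∣ Δ²) ⟩
        + (C ℕ.* y ^ j) * + ∣ Δ² ∣    ≡⟨ ℤₚ.pos-* (C ℕ.* y ^ j) ∣ Δ² ∣ ⟨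
        + (C ℕ.* y ^ j ℕ.* ∣ Δ² ∣)    ∎)
        where
        open ℤₚ.≤-Reasoning
        i≤∣i∣ : ∀ i → i ℤ.≤ + ∣ i ∣
        i≤∣i∣ (+ m)      = ℤₚ.≤-refl
        i≤∣i∣ ℤ.-[1+ m ] = ℤ.-≤+

    private
      difference : + powerSum (suc j) n * + (10 ^ suc j) - + (y ^ suc j) * + count n ≡ + slope * Δ + R
      difference = trans
        (cong (_- + (y ^ suc j) * + count n)
          (trans (ℤₚ.*-comm (+ powerSum (suc j) n) (+ (10 ^ suc j))) expansion))
        (solve 4 (λ c p s r → ((c :* p :+ s) :+ r) :- p :* c := s :+ r) refl
          (+ count n) (+ (y ^ suc j)) (+ slope * Δ) R)

      -- The factor `y` matches the form of `y∣R∣≤` and is cancelled in `powerSum-bound`. As n³ = y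
      -- n, both error terms have the same order.
      scaled : y ℕ.* ∣ + slope * Δ + R ∣ ℕ.≤ y ℕ.* (bound-coeff j ℕ.* (y ^ j ℕ.* n) ℕ.* count n)
      scaled = begin
        y ℕ.* ∣ + slope * Δ + R ∣
          ≤⟨ ℕₚ.*-monoʳ-≤ y (ℤₚ.∣i+j∣≤∣i∣+∣j∣ (+ slope * Δ) R) ⟩
        y ℕ.* (∣ + slope * Δ ∣ ℕ.+ ∣ R ∣)
          ≡⟨ trans (ℕₚ.*-distribˡ-+ y _ _) (cong (λ a → y ℕ.* a ℕ.+ y ℕ.* ∣ R ∣) (ℤₚ.abs-* (+ slope) Δ)) ⟩
        y ℕ.* (slope ℕ.* ∣ Δ ∣) ℕ.+ y ℕ.* ∣ R ∣
          ≤⟨ ℕₚ.+-mono-≤ (ℕₚ.*-monoʳ-≤ y (ℕₚ.*-monoʳ-≤ slope (∣total-deviation∣≤ 0<n)))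
               (ℕₚ.≤-trans y∣R∣≤ (ℕₚ.*-monoʳ-≤ (C ℕ.* y ^ j) (∣total-deviation²∣≤ 0<n))) ⟩
        y ℕ.* (slope ℕ.* (12900 ℕ.* (n ^ 1 ℕ.* count n))) ℕ.+ C ℕ.* y ^ j ℕ.* (57500 ℕ.* (n ^ 3 ℕ.* count n))
          ≡⟨ regroup 12900 57500 ⟩
        y ℕ.* (bound-coeff j ℕ.* (y ^ j ℕ.* n) ℕ.* count n) ∎
        where
        open ℕₚ.≤-Reasoning
        -- Variables replace the numerals 12900 and 57500, which thus stay opaque to the solver.
        regroup : ∀ a b →
          y ℕ.* (slope ℕ.* (a ℕ.* (n ^ 1 ℕ.* count n))) ℕ.+ C ℕ.* y ^ j ℕ.* (b ℕ.* (n ^ 3 ℕ.* count n))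
          ≡ y ℕ.* ((a ℕ.* suc j ℕ.+ b ℕ.* C) ℕ.* (y ^ j ℕ.* n) ℕ.* count n)
        regroup a b = ℕ-solve 7 (λ a b n j p C u →
            n ⊗ n ⊗ (j ⊗ p ⊗ (a ⊗ (n ⊗ κ 1 ⊗ u))) ⊕ C ⊗ p ⊗ (b ⊗ (n ⊗ (n ⊗ (n ⊗ κ 1)) ⊗ u))
              ⊜ n ⊗ n ⊗ ((a ⊗ j ⊕ b ⊗ C) ⊗ (p ⊗ n) ⊗ u))
          refl a b n (suc j) (y ^ j) C (count n)

    powerSum-bound : ∣ + powerSum (suc j) n * + (10 ^ suc j) - + (y ^ suc j) * + count n ∣
      ℕ.≤ bound-coeff j ℕ.* (y ^ j ℕ.* n) ℕ.* count n
    powerSum-bound = subst (λ i → ∣ i ∣ ℕ.≤ bound-coeff j ℕ.* (y ^ j ℕ.* n) ℕ.* count n) (sym difference)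
      (ℕₚ.*-cancelˡ-≤ y {{ℕ.>-nonZero (ℕₚ.*-mono-≤ 0<n 0<n)}} scaled)

  -- From integer sums to rational averages.

  toℚᵘ-/ : ∀ i m .{{_ : ℕ.NonZero m}} → toℚᵘ (i ℚ./ m) ℚᵘ.≃ i ℚᵘ./ m
  toℚᵘ-/ i (suc m) = ℚₚ.toℚᵘ-fromℚᵘ (mkℚᵘ i m)

  1/10^ : ∀ k → toℚᵘ ((+ 1 ℚ./ 10) ^ℚ k) ℚᵘ.≃ (+ 1 ℚᵘ./ (10 ^ k)) {{ℕₚ.m^n≢0 10 k}}
  1/10^ zero    = *≡* refl
  1/10^ (suc k) = ℚᵘₚ.≃-trans (ℚₚ.toℚᵘ-homo-* (+ 1 ℚ./ 10) ((+ 1 ℚ./ 10) ^ℚ k))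
    (ℚᵘₚ.≃-trans (ℚᵘₚ.*-cong (toℚᵘ-/ (+ 1) 10) (1/10^ k)) (unit (10 ^ k) {{ℕₚ.m^n≢0 10 k}}))
    where
    unit : ∀ m .{{_ : ℕ.NonZero m}} →
      mkℚᵘ (+ 1) 9 ℚᵘ.* (+ 1 ℚᵘ./ m) ℚᵘ.≃ (+ 1 ℚᵘ./ (10 ℕ.* m)) {{ℕₚ.m*n≢0 10 m}}
    unit (suc m) = *≡* refl

  -- Over the common denominator l d the numerator is A d - P l. Its bound M l gives M / d, which is
  -- at most M.
  ∣a/l-b/d∣≤ᵘ : ∀ {A P M} l d .{{_ : ℕ.NonZero l}} .{{_ : ℕ.NonZero d}} →
    ∣ + A * + d - + P * + l ∣ ℕ.≤ M ℕ.* l →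
    ℚᵘ.∣ (+ A ℚᵘ./ l) ℚᵘ.- (+ 1 ℚᵘ./ d) ℚᵘ.* (+ P ℚᵘ./ 1) ∣ ℚᵘ.≤ + M ℚᵘ./ 1
  ∣a/l-b/d∣≤ᵘ {A} {P} {M} l@(suc _) d@(suc _) le = *≤* (subst₂ ℤ._≤_
    (trans (cong +_ (cong ∣_∣ (solve 4 (λ a d p l → a :* d :- p :* l
        := a :* (d :* con (+ 1)) :+ (:- (con (+ 1) :* p)) :* l) refl (+ A) (+ d) (+ P) (+ l))))
      (sym (ℤₚ.*-identityʳ _)))
    refl
    (ℤₚ.≤-trans (ℤ.+≤+ (ℕₚ.≤-trans le (ℕₚ.*-monoʳ-≤ M (ℕₚ.m≤m*n l (d ℕ.* 1)))))
      (ℤₚ.≤-reflexive (ℤₚ.pos-* M (l ℕ.* (d ℕ.* 1))))))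

  -- For a non-empty list `moment` is the genuine quotient, and the estimate can be checked on
  -- unnormalised fractions.
  moment-approx : ∀ k L P M → 0 ℕ.< length L →
    ∣ + sum (map (λ λs → size λs ^ k) L) * + (10 ^ k) - + P * + length L ∣ ℕ.≤ M ℕ.* length L →
    ℚ.∣ moment k L ℚ.- ((+ 1 ℚ./ 10) ^ℚ k) ℚ.* (+ P ℚ./ 1) ∣ ℚ.≤ + M ℚ./ 1
  moment-approx k L@(_ ∷ _) P M _ le = ℚₚ.toℚᵘ-cancel-≤
    (ℚᵘₚ.≤-respʳ-≃ (ℚᵘₚ.≃-sym (toℚᵘ-/ (+ M) 1))
      (ℚᵘₚ.≤-respˡ-≃ (ℚᵘₚ.≃-sym unnormalise)
        (∣a/l-b/d∣≤ᵘ (length L) (10 ^ k) {{_}} {{ℕₚ.m^n≢0 10 k}} le)))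
    where
    A = sum (map (λ λs → size λs ^ k) L)
    c = (+ 1 ℚ./ 10) ^ℚ k
    product : toℚᵘ (c ℚ.* (+ P ℚ./ 1)) ℚᵘ.≃ (+ 1 ℚᵘ./ (10 ^ k)) {{ℕₚ.m^n≢0 10 k}} ℚᵘ.* (+ P ℚᵘ./ 1)
    product = ℚᵘₚ.≃-trans (ℚₚ.toℚᵘ-homo-* c (+ P ℚ./ 1)) (ℚᵘₚ.*-cong (1/10^ k) (toℚᵘ-/ (+ P) 1))
    unnormalise : toℚᵘ ℚ.∣ moment k L ℚ.- c ℚ.* (+ P ℚ./ 1) ∣ ℚᵘ.≃
      ℚᵘ.∣ (+ A ℚᵘ./ length L) ℚᵘ.- (+ 1 ℚᵘ./ (10 ^ k)) {{ℕₚ.m^n≢0 10 k}} ℚᵘ.* (+ P ℚᵘ./ 1) ∣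
    unnormalise = ℚᵘₚ.≃-trans (ℚₚ.toℚᵘ-homo-∣-∣ (moment k L ℚ.- c ℚ.* (+ P ℚ./ 1)))
      (ℚᵘₚ.∣-∣-cong (ℚᵘₚ.≃-trans (ℚₚ.toℚᵘ-homo-+ (moment k L) (ℚ.- (c ℚ.* (+ P ℚ./ 1))))
        (ℚᵘₚ.+-cong (toℚᵘ-/ (+ A) (length L))
          (ℚᵘₚ.≃-trans (ℚₚ.toℚᵘ-homo‿- (c ℚ.* (+ P ℚ./ 1))) (ℚᵘₚ.-‿cong product)))))

-- The asymptotic formula.

open Enumeration using (cores; cores-enumerates)
open Asymptotics using (bound-coeff; count-pos; powerSum-bound; moment-approx)
open import Data.Nat using (ℕ; zero; suc; _+_; _*_; _^_; _∸_; _≤_)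
open import Data.List using (List)
open import Data.Product using (Σ; ∃; _×_; _,_)
open import Data.Integer using (+_)
open import Data.Rational using (ℚ; ∣_∣; _-_; _/_) renaming (_*_ to _*ℚ_; _≤_ to _≤ℚ_)

square-^ : ∀ n k → (n * n) ^ k ≡ n ^ (2 * k)
square-^ n k = trans (cong (λ m → (n * m) ^ k) (sym (ℕₚ.*-identityʳ n))) (ℕₚ.^-*-assoc n 2 k)

square-^-* : ∀ n j → (n * n) ^ j * n ≡ n ^ (2 * suc j ∸ 1)
square-^-* n j = trans (cong (_* n) (square-^ n j))
  (trans (ℕₚ.*-comm (n ^ (2 * j)) n) (cong (n ^_) (sym (ℕₚ.+-suc j (j + 0)))))

theorem1p9 : (k : ℕ) → 1 ≤ k →
    ∃ λ (C : ℕ) → ∃ λ (N : ℕ) → ∀ n → N ≤ n →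
    Σ (List (List ℕ)) λ L → Enumerates n L ×
    (∣ moment k L - ((+ 1 / 10) ^ℚ k) *ℚ (+ (n ^ (2 * k)) / 1) ∣
    ≤ℚ (+ (C * n ^ (2 * k ∸ 1)) / 1))
theorem1p9 zero ()
-- The estimate holds from n = 1 on, with a constant depending on k only.
theorem1p9 k@(suc j) _ = bound-coeff j , 1 , λ n 1≤n → cores n , cores-enumerates 1≤n ,
  subst₂ (λ P E → ∣ moment k (cores n) - ((+ 1 / 10) ^ℚ k) *ℚ (+ P / 1) ∣ ≤ℚ (+ (bound-coeff j * E) / 1))
    (square-^ n k) (square-^-* n j)
    (moment-approx k (cores n) ((n * n) ^ k) (bound-coeff j * ((n * n) ^ j * n)) (count-pos n)
      (powerSum-bound j 1≤n))
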